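{- There exist absolute constants $C>0$ and $q_0\in(0,1)$ such that the following hold for all $\varepsilon\in(0,1)$, all $q\in(0,q_0]$ and all $D>1$ with $\varepsilon D$ a positive integer. (A) For every metric space $(X,d)$ there is an online algorithm with predictions for the page migration problem on $(X,d)$ with parameter $D$ that is $(1+\varepsilon)(1+Cq)$-competitive on all inputs satisfying the $(\varepsilon,q)$-error assumption. (B) For every uniform metric space $(X,d)$ there is an online algorithm with predictions for the page migration problem on $(X,d)$ with parameter $D$ that is $(1+Cq)$-competitive on all inputs satisfying the $(\varepsilon,q)$-error assumption.
   Context: Page migration problem. Let $(X,d)$ be a metric space, $D>1$ a parameter, and $p_0\in X$ a start position. For a request sequence $s=(s_1,\dots,s_n)\in X^n$ and a sequence of page positions $a=(a_1,\dots,a_n)\in X^n$, with $a_0:=p_0$, the cost of $a$ on $s$ is $\sum_{i=1}^n \left(D\, d(a_{i-1},a_i)+d(a_i,s_i)\right)$. A metric space is uniform if $d(p,p')=1$ for all $p\neq p'$. Online algorithm with predictions. An input consists of a start position $p_0$, a length $n$, a predicted sequence $\hat s\in X^n$ and an actual sequence $s\in X^n$. The algorithm knows $p_0$, $n$, $\hat s$ (and $D,\varepsilon,q$) in advance, but sees $s$ online: after $s_i$ is revealed it irrevocably chooses $a_i\in X$, so $a_i$ depends only on $p_0,n,\hat s$ and $s_1,\dots,s_i$. It is $\rho$-competitive on a class of inputs if, for every input in the class, its cost on $s$ is at most $\rho$ times the cost on $s$ of every sequence $(o_1,\dots,o_n)\in X^n$ of page positions starting from $p_0$ (i.e. at most $\rho$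 times the optimal offline cost for $s$). $(\varepsilon,q)$-error assumption. For an interval $\mathcal I\subseteq\{1,\dots,n\}$ of consecutive indices let $m(\mathcal I)=|\{t\in\mathcal I: s_t\neq\hat s_t\}|$ be the number of mismatches. The input satisfies the $(\varepsilon,q)$-error assumption if $m(\mathcal I)\le q\varepsilon D$ for every interval $\mathcal I\subseteq\{1,\dots,n\}$ of length $\varepsilon D$. -}

module Defs where

open import Algebra.Bundles using (CommutativeRing)
import Algebra.Definitions.RawMonoid as RawMonoidDefs
open import Data.Fin.Base using (Fin; toℕ)
open import Data.Fin.Properties using (toℕ<n)
open import Data.Nat.Base as ℕ using (ℕ; suc)
import Data.Nat.Properties as ℕ
open import Data.Product.Base using (∃-syntax; _×_)
open import Data.Vec.Base using (Vec; []; _∷_; allFin; count; lookup; tabulate; truncate)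
open import Function.Metric.Structures using (IsGeneralMetric)
open import Level using (0ℓ) renaming (suc to lsuc)
open import Relation.Binary.Core using (Rel)
open import Relation.Binary.Definitions using (DecidableEquality)
open import Relation.Binary.PropositionalEquality.Core using (_≡_; _≢_)
import Relation.Binary.Construct.NonStrictToStrict as ToStrict
open import Relation.Binary.Structures using (IsTotalOrder)
open import Relation.Nullary.Decidable using (¬?; _×-dec_)
open import Relation.Nullary.Negation using (¬_)
open import Relation.Unary using (Pred)

-- The real numbers, axiomatised as a (Dedekind-)complete ordered field; any two
-- models are isomorphic.
record RealField : Set₁ where
  field
    commutativeRing : CommutativeRing 0ℓ 0ℓ

  open CommutativeRing commutativeRing public
    using (Carrier; _≈_; _+_; _*_; -_; 0#; 1#; +-rawMonoid)

  infix 4 _≤_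

  field
    _≤_          : Rel Carrier 0ℓ
    isTotalOrder : IsTotalOrder _≈_ _≤_
    0≉1          : ¬ (0# ≈ 1#)
    inverse      : ∀ x → ¬ (x ≈ 0#) → ∃[ y ] x * y ≈ 1#
    +-monoʳ-≤    : ∀ x {y z} → y ≤ z → x + y ≤ x + z
    *-nonNeg     : ∀ {x y} → 0# ≤ x → 0# ≤ y → 0# ≤ x * y

  UpperBound : Pred Carrier 0ℓ → Pred Carrier 0ℓ
  UpperBound P b = ∀ {x} → P x → x ≤ b

  field
    supremum : ∀ (P : Pred Carrier 0ℓ) → ∃[ x ] P x → ∃[ b ] UpperBound P b →
               ∃[ s ] (UpperBound P s × (∀ {b} → UpperBound P b → s ≤ b))

  open ToStrict _≈_ _≤_ public using (_<_)

  fromℕ : ℕ → Carrier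
  fromℕ n = RawMonoidDefs._×_ +-rawMonoid n 1#

  IsPositiveInteger : Pred Carrier 0ℓ
  IsPositiveInteger x = ∃[ k ] (0 ℕ.< k × x ≈ fromℕ k)

record MetricSpace (ℝ : RealField) a : Set (lsuc a) where
  private module ℝ = RealField ℝ
  field
    Point    : Set a
    d        : Point → Point → ℝ.Carrier
    isMetric : IsGeneralMetric _≡_ ℝ._≈_ ℝ._≤_ ℝ.0# ℝ._+_ d

  IsUniform : Set a
  IsUniform = ∀ p p′ → p ≢ p′ → d p p′ ℝ.≈ ℝ.1#

-- Given the start position, n and the prediction, the page position for the
-- (0-based) index i is computed from the first suc i requests only.
OnlineAlgorithm : ∀ {a} → Set a → Set a
OnlineAlgorithm X = (p₀ : X) (n : ℕ) (ŝ : Vec X n)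
                    (i : Fin n) → Vec X (suc (toℕ i)) → X

run : ∀ {a} {X : Set a} → OnlineAlgorithm X →
      X → ∀ {n} → Vec X n → Vec X n → Vec X n
run alg p₀ {n} ŝ s = tabulate λ i → alg p₀ n ŝ i (truncate (toℕ<n i) s)

-- Mismatches at the k consecutive (0-based) indices j, …, j + k − 1.
mismatches : ∀ {a} {X : Set a} → DecidableEquality X →
             ∀ {n} → Vec X n → Vec X n → (j k : ℕ) → ℕ
mismatches _≟_ {n} s ŝ j k =
  count (λ t → (j ℕ.≤? toℕ t ×-dec toℕ t ℕ.<? j ℕ.+ k)
               ×-dec ¬? (lookup s t ≟ lookup ŝ t))
        (allFin n)

module _ {a} (ℝ : RealField) (M : MetricSpace ℝ a) where
  open RealField ℝ
  open MetricSpace M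

  cost : Carrier → Point → ∀ {n} → Vec Point n → Vec Point n → Carrier
  cost D p₀ []       []       = 0#
  cost D p₀ (a ∷ as) (s ∷ ss) = (D * d p₀ a + d a s) + cost D a as ss

  ErrorAssumption : DecidableEquality Point → (D ε q : Carrier) →
                    ∀ {n} → Vec Point n → Vec Point n → Set
  ErrorAssumption _≟_ D ε q {n} ŝ s =
    ∀ j k → j ℕ.+ k ℕ.≤ n → fromℕ k ≈ ε * D →
    fromℕ (mismatches _≟_ s ŝ j k) ≤ q * (ε * D)

  Competitive : DecidableEquality Point → (D ε q ρ : Carrier) →
                OnlineAlgorithm Point → Set a
  Competitive _≟_ D ε q ρ alg =
    ∀ p₀ n (ŝ s : Vec Point n) → ErrorAssumption _≟_ D ε q ŝ s →
    ∀ (o : Vec Point n) → cost D p₀ (run alg p₀ ŝ s) s ≤ ρ * cost D p₀ o s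

{-# OPTIONS --safe #-}
module Submission where

-- The algorithm follows an offline solution x that is (nearly) optimal for the
-- prediction ŝ.  For any other solution o, replacing ŝ by s changes the cost
-- difference of x and o by at most 2 d(x_t, o_t) per mismatch t.  In a window of
-- k = εD indices, d(x_t, o_t) varies by at most the movement of x and o, and k times
-- the movement is bounded by the movement cost; averaging d(x_t, o_t) ≤ d(x_t, s_t) +
-- d(o_t, s_t) over the window, the mismatches cost O(q) times the total cost of x and
-- o there.  This yields the ratio 1 + O(q) in every metric space.
--
-- If n < k, the error assumption is void, but never moving is optimal.  Since an
-- optimal offline solution need not exist in an infinite space, x is only optimal up
-- to an additive q c.  This is harmless when every admissible s contains a correctly
-- predicted request other than p₀, for then any solution costs at least c, the least
-- distance from p₀ to another predicted request.  Otherwise an admissible s₀ shows that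
-- ŝ is p₀ up to few mismatches, and never moving, which is optimal for the constant
-- sequence p₀, is good enough.

open import Algebra.Bundles using (CommutativeRing)
open import Axiom.ExcludedMiddle using (ExcludedMiddle)
open import Data.Bool.Base using (true; false; if_then_else_)
open import Data.Empty using (⊥-elim)
open import Data.Fin.Base using (Fin; zero; suc; toℕ)
open import Data.Nat.Base as ℕ using (ℕ; zero; suc; z≤n; s≤s; z<s)
open import Data.Nat.DivMod using (_/_; _%_; m≡m%n+[m/n]*n; m%n<n)
import Data.Nat.Properties as ℕ
open import Data.Product.Base using (∃-syntax; _×_; _,_; proj₁; proj₂)
open import Data.Sum.Base using (_⊎_; inj₁; inj₂)
open import Data.Vec.Base using (Vec; []; _∷_; count; lookup; replicate; tabulate)
open import Data.Vec.Properties using (tabulate∘lookup)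
open import Function.Base using (_∘_; const)
open import Function.Metric.Structures using (IsGeneralMetric)
open import Level using (0ℓ)
open import Relation.Binary.Bundles using (Poset)
open import Relation.Binary.Definitions using (DecidableEquality)
open import Relation.Binary.PropositionalEquality.Core as ≡ using (_≡_; _≢_)
open import Relation.Binary.Structures using (IsTotalOrder)
open import Relation.Nullary.Decidable using (Dec; yes; no; does; True; toWitness; fromWitness; ¬?; _×-dec_)
open import Relation.Nullary.Negation using (¬_)
open import Relation.Unary using (Decidable)
open import Defs

-- Arithmetic in an ordered field

module OrderedField (ℝ : RealField) where
  open RealField ℝ public
  open CommutativeRing commutativeRing public
    using ( commutativeSemiring; refl; reflexive; sym; trans
          ; +-cong; +-congˡ; +-congʳ; *-congˡ; *-congʳ
          ; +-identityˡ; +-identityʳ; *-identityˡ; *-identityʳ; zeroˡ; zeroʳ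
          ; -‿inverseʳ; +-assoc; +-comm; *-comm; distribˡ )
  open IsTotalOrder isTotalOrder public
    using (total; antisym; isPartialOrder)
    renaming (refl to ≤-refl; trans to ≤-trans; reflexive to ≤-reflexive)
  open import Algebra.Solver.Ring.NaturalCoefficients.Default commutativeSemiring public
    using (solve; _:+_; _:*_; _:×_; _:=_; con)

  poset : Poset 0ℓ 0ℓ 0ℓ
  poset = record { isPartialOrder = isPartialOrder }

  open import Relation.Binary.Reasoning.PartialOrder poset public

  +-mono-≤ : ∀ {w x y z} → w ≤ x → y ≤ z → w + y ≤ x + z
  +-mono-≤ {w} {x} {y} {z} w≤x y≤z = begin
    w + y ≤⟨ +-monoʳ-≤ w y≤z ⟩
    w + z ≈⟨ +-comm w z ⟩
    z + w ≤⟨ +-monoʳ-≤ z w≤x ⟩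
    z + x ≈⟨ +-comm z x ⟩
    x + z ∎

  +-cancelʳ-≤ : ∀ z {x y} → x + z ≤ y + z → x ≤ y
  +-cancelʳ-≤ z {x} {y} x+z≤y+z = begin
    x              ≈⟨ cancel x ⟨
    (x + z) + (- z) ≤⟨ +-mono-≤ x+z≤y+z ≤-refl ⟩
    (y + z) + (- z) ≈⟨ cancel y ⟩
    y              ∎
    where
    cancel : ∀ w → (w + z) + (- z) ≈ w
    cancel w = trans (+-assoc w z (- z)) (trans (+-congˡ (-‿inverseʳ z)) (+-identityʳ w))

  -- Derives an inequality from a hypothesis x ≤ y and the subtraction-free form
  -- of  right − left ≈ y − x, which the semiring solver can check.
  from-≤ : ∀ {x y l r} → x ≤ y → l + y ≈ r + x → l ≤ r
  from-≤ {x} {y} {l} {r} x≤y eq = +-cancelʳ-≤ y (begin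
    l + y ≈⟨ eq ⟩
    r + x ≤⟨ +-monoʳ-≤ r x≤y ⟩
    r + y ∎)

  -- Naming the gap between `x` and `y` keeps later identities free of subtraction, as the semiring
  -- solver requires.
  difference : ∀ {x y} → x ≤ y → ∃[ z ] (0# ≤ z × x + z ≈ y)
  difference {x} {y} x≤y = y + - x
    , (begin 0# ≈⟨ -‿inverseʳ x ⟨ x + - x ≤⟨ +-mono-≤ x≤y ≤-refl ⟩ y + - x ∎)
    , trans (solve 3 (λ x y z → x :+ (y :+ z) := y :+ (x :+ z)) refl x y (- x))
            (trans (+-congˡ (-‿inverseʳ x)) (+-identityʳ y))

  *-monoʳ-≤ : ∀ {c x y} → 0# ≤ c → x ≤ y → c * x ≤ c * y
  *-monoʳ-≤ {c} {x} {y} 0≤c x≤y with z , 0≤z , x+z≈y ← difference x≤y =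
    from-≤ (*-nonNeg 0≤c 0≤z)
      (trans (trans (sym (distribˡ c x z)) (*-congˡ x+z≈y)) (sym (+-identityʳ _)))

  x≤x+y : ∀ x {y} → 0# ≤ y → x ≤ x + y
  x≤x+y x 0≤y = from-≤ 0≤y (sym (+-identityʳ _))

  x≤y+x : ∀ {y} x → 0# ≤ y → x ≤ y + x
  x≤y+x x 0≤y = ≤-trans (x≤x+y x 0≤y) (≤-reflexive (+-comm _ _))

  +-nonNeg : ∀ {x y} → 0# ≤ x → 0# ≤ y → 0# ≤ x + y
  +-nonNeg {x} 0≤x 0≤y = ≤-trans 0≤x (x≤x+y x 0≤y)

  0≤1 : 0# ≤ 1#
  0≤1 with total 0# 1#
  ... | inj₁ h = h
  -- Here `z` is minus one, so its square, which is nonnegative, equals one.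
  ... | inj₂ h with z , 0≤z , 1+z≈0 ← difference h = begin
    0#               ≤⟨ *-nonNeg 0≤z 0≤z ⟩
    z * z            ≈⟨ +-identityʳ _ ⟨
    z * z + 0#       ≈⟨ +-congˡ 1+z≈0 ⟨
    z * z + (1# + z) ≈⟨ solve 1 (λ z → z :* z :+ (con 1 :+ z) := z :* (con 1 :+ z) :+ con 1) refl z ⟩
    z * (1# + z) + 1# ≈⟨ +-congʳ (trans (*-congˡ 1+z≈0) (zeroʳ z)) ⟩
    0# + 1#          ≈⟨ +-identityˡ 1# ⟩
    1#               ∎

  1≰0 : ¬ (1# ≤ 0#)
  1≰0 1≤0 = 0≉1 (antisym 0≤1 1≤0)

  ≰⇒> : ∀ {x y} → ¬ (y ≤ x) → x < y
  ≰⇒> {x} {y} y≰x with total x y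
  ... | inj₁ x≤y = x≤y , λ x≈y → y≰x (≤-reflexive (sym x≈y))
  ... | inj₂ y≤x = ⊥-elim (y≰x y≤x)

  <⇒≱ : ∀ {x y} → x < y → ¬ (y ≤ x)
  <⇒≱ (x≤y , x≉y) y≤x = x≉y (antisym x≤y y≤x)

  *-cancelˡ-≤ : ∀ c {x y} → 0# < c → c * x ≤ c * y → x ≤ y
  *-cancelˡ-≤ c {x} {y} (0≤c , 0≉c) cx≤cy with total x y
  ... | inj₁ x≤y = x≤y
  -- Monotonicity gives the reverse of the hypothesis, so `c * x` and `c * y` are equal and `c` can
  -- be inverted.
  ... | inj₂ y≤x with c⁻¹ , cc⁻¹≈1 ← inverse c (0≉c ∘ sym) = begin
    x             ≈⟨ cancel x ⟨
    c⁻¹ * (c * x) ≈⟨ *-congˡ (antisym cx≤cy (*-monoʳ-≤ 0≤c y≤x)) ⟩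
    c⁻¹ * (c * y) ≈⟨ cancel y ⟩
    y             ∎
    where
    cancel : ∀ w → c⁻¹ * (c * w) ≈ w
    cancel w = trans (solve 3 (λ c i w → i :* (c :* w) := c :* i :* w) refl c c⁻¹ w)
                     (trans (*-congʳ cc⁻¹≈1) (*-identityˡ w))

  *-pos : ∀ {x y} → 0# < x → 0# < y → 0# < x * y
  *-pos {x} {y} 0<x 0<y = ≰⇒> λ xy≤0 →
    <⇒≱ 0<y (*-cancelˡ-≤ x 0<x (≤-trans xy≤0 (≤-reflexive (sym (zeroʳ x)))))

  fromℕ-nonNeg : ∀ n → 0# ≤ fromℕ n
  fromℕ-nonNeg zero    = ≤-refl
  fromℕ-nonNeg (suc n) = +-nonNeg 0≤1 (fromℕ-nonNeg n)

  1≤fromℕ : ∀ {n} → 0 ℕ.< n → 1# ≤ fromℕ n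
  1≤fromℕ {suc n} _ = x≤x+y 1# (fromℕ-nonNeg n)

  fromℕ-mono : ∀ {m n} → m ℕ.≤ n → fromℕ m ≤ fromℕ n
  fromℕ-mono {n = n} z≤n = fromℕ-nonNeg n
  fromℕ-mono (s≤s m≤n)   = +-monoʳ-≤ 1# (fromℕ-mono m≤n)

  1≤⇒0< : ∀ {x} → 1# ≤ x → 0# < x
  1≤⇒0< 1≤x = ≰⇒> λ x≤0 → 1≰0 (≤-trans 1≤x x≤0)

  -- With E = y − z and c ≤ 1/16 the hypothesis reads E ≤ 8c (E + 2z) ≤ E/2 + 16cz.
  absorb-error : ∀ {c y z} → 0# ≤ c → fromℕ 16 * c ≤ 1# → 0# ≤ z →
                 y ≤ z + fromℕ 8 * c * (y + z) → y ≤ (1# + fromℕ 32 * c) * z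
  absorb-error {c} {y} {z} 0≤c 16c≤1 0≤z h with total y z
  ... | inj₁ y≤z = ≤-trans y≤z (from-≤ (*-nonNeg (*-nonNeg (fromℕ-nonNeg 32) 0≤c) 0≤z)
      (solve 3 (λ t c z → z :+ t :* c :* z := (con 1 :+ t :* c) :* z :+ con 0)
        refl (fromℕ 32) c z))
  ... | inj₂ z≤y with e , 0≤e , z+e≈y ← difference z≤y = begin
    y      ≈⟨ z+e≈y ⟨
    z + e  ≤⟨ from-≤ (+-mono-≤ (+-mono-≤ h′ h′) (*-monoʳ-≤ 0≤e 16c≤1))
                (solve 3 (λ c z e →
                    (z :+ e) :+ ((z :+ (8 :× con 1) :* c :* ((z :+ e) :+ z))
                                 :+ (z :+ (8 :× con 1) :* c :* ((z :+ e) :+ z)) :+ e :* con 1)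
                    := (con 1 :+ (32 :× con 1) :* c) :* z
                       :+ ((z :+ e) :+ (z :+ e) :+ e :* ((16 :× con 1) :* c)))
                  refl c z e) ⟩
    (1# + fromℕ 32 * c) * z ∎
    where
    h′ : z + e ≤ z + fromℕ 8 * c * ((z + e) + z)
    h′ = begin
      z + e                            ≈⟨ z+e≈y ⟩
      y                                ≤⟨ h ⟩
      z + fromℕ 8 * c * (y + z)        ≈⟨ +-congˡ (*-congˡ (+-congʳ z+e≈y)) ⟨
      z + fromℕ 8 * c * ((z + e) + z)  ∎

-- Finite sums, windows and averaging

module Sums (ℝ : RealField) where
  open OrderedField ℝ

  sum : ℕ → (ℕ → Carrier) → Carrier
  sum zero    f = 0#
  sum (suc n) f = f 0 + sum n (f ∘ suc)

  sum-cong : ∀ n {f g} → (∀ t → t ℕ.< n → f t ≈ g t) → sum n f ≈ sum n g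
  sum-cong zero    eq = refl
  sum-cong (suc n) eq = +-cong (eq 0 z<s) (sum-cong n λ t t<n → eq (suc t) (s≤s t<n))

  sum-mono : ∀ n {f g} → (∀ t → t ℕ.< n → f t ≤ g t) → sum n f ≤ sum n g
  sum-mono zero    le = ≤-refl
  sum-mono (suc n) le = +-mono-≤ (le 0 z<s) (sum-mono n λ t t<n → le (suc t) (s≤s t<n))

  sum-nonNeg : ∀ n {f} → (∀ t → 0# ≤ f t) → 0# ≤ sum n f
  sum-nonNeg zero    le = ≤-refl
  sum-nonNeg (suc n) le = +-nonNeg (le 0) (sum-nonNeg n (le ∘ suc))

  sum-+ : ∀ n f g → sum n (λ t → f t + g t) ≈ sum n f + sum n g
  sum-+ zero    f g = sym (+-identityˡ 0#)
  sum-+ (suc n) f g = trans (+-congˡ (sum-+ n (f ∘ suc) (g ∘ suc)))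
    (solve 4 (λ a b c d → (a :+ b) :+ (c :+ d) := (a :+ c) :+ (b :+ d)) refl _ _ _ _)

  sum-*ˡ : ∀ n c f → sum n (λ t → c * f t) ≈ c * sum n f
  sum-*ˡ zero    c f = sym (zeroʳ c)
  sum-*ˡ (suc n) c f = trans (+-congˡ (sum-*ˡ n c (f ∘ suc))) (sym (distribˡ c _ _))

  sum-const : ∀ n x → sum n (const x) ≈ fromℕ n * x
  sum-const zero    x = sym (zeroˡ x)
  sum-const (suc n) x = trans (+-congˡ (sum-const n x))
    (solve 2 (λ m x → x :+ m :* x := (con 1 :+ m) :* x) refl (fromℕ n) x)

  sum-split : ∀ m n f → sum (m ℕ.+ n) f ≈ sum m f + sum n (f ∘ (m ℕ.+_))
  sum-split zero    n f = sym (+-identityˡ _)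
  sum-split (suc m) n f = trans (+-congˡ (sum-split m n (f ∘ suc))) (sym (+-assoc _ _ _))

  window≤sum : ∀ {j k n f} → (∀ t → 0# ≤ f t) → j ℕ.+ k ℕ.≤ n → sum k (f ∘ (j ℕ.+_)) ≤ sum n f
  window≤sum {j} {k} {n} {f} 0≤f j+k≤n = begin
    sum k (f ∘ (j ℕ.+_))              ≤⟨ x≤y+x _ (sum-nonNeg j 0≤f) ⟩
    sum j f + sum k (f ∘ (j ℕ.+_))    ≈⟨ sum-split j k f ⟨
    sum (j ℕ.+ k) f                   ≤⟨ x≤x+y _ (sum-nonNeg r (λ t → 0≤f (j ℕ.+ k ℕ.+ t))) ⟩
    sum (j ℕ.+ k) f + sum r (f ∘ (j ℕ.+ k ℕ.+_)) ≈⟨ sum-split (j ℕ.+ k) r f ⟨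
    sum (j ℕ.+ k ℕ.+ r) f             ≡⟨ ≡.cong (λ m → sum m f) (ℕ.m+[n∸m]≡n j+k≤n) ⟩
    sum n f                           ∎
    where r = n ℕ.∸ (j ℕ.+ k)

  WindowwiseLE : ℕ → ℕ → (f g : ℕ → Carrier) → Set
  WindowwiseLE k n f g = ∀ j → j ℕ.+ k ℕ.≤ n → sum k (f ∘ (j ℕ.+_)) ≤ sum k (g ∘ (j ℕ.+_))

  windowwise-shift : ∀ k r m {f g} → WindowwiseLE k (r ℕ.+ m) f g →
                     WindowwiseLE k m (f ∘ (r ℕ.+_)) (g ∘ (r ℕ.+_))
  windowwise-shift k r m {f} {g} le j j+k≤m = begin
    sum k (λ t → f (r ℕ.+ (j ℕ.+ t))) ≈⟨ sum-cong k (λ t _ → assoc f t) ⟨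
    sum k (λ t → f (r ℕ.+ j ℕ.+ t))   ≤⟨ le (r ℕ.+ j) (≡.subst (ℕ._≤ r ℕ.+ m)
                                           (≡.sym (ℕ.+-assoc r j k)) (ℕ.+-monoʳ-≤ r j+k≤m)) ⟩
    sum k (λ t → g (r ℕ.+ j ℕ.+ t))   ≈⟨ sum-cong k (λ t _ → assoc g t) ⟩
    sum k (λ t → g (r ℕ.+ (j ℕ.+ t))) ∎
    where
    assoc : ∀ h t → h (r ℕ.+ j ℕ.+ t) ≈ h (r ℕ.+ (j ℕ.+ t))
    assoc h t = reflexive (≡.cong h (ℕ.+-assoc r j t))

  blocks : ∀ k m {f g} → WindowwiseLE k (m ℕ.* k) f g → sum (m ℕ.* k) f ≤ sum (m ℕ.* k) g
  blocks k zero            le = ≤-refl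
  blocks k (suc m) {f} {g} le = begin
    sum (k ℕ.+ m ℕ.* k) f                     ≈⟨ sum-split k (m ℕ.* k) f ⟩
    sum k f + sum (m ℕ.* k) (f ∘ (k ℕ.+_))    ≤⟨ +-mono-≤ (le 0 (ℕ.m≤m+n k _))
                                                   (blocks k m (windowwise-shift k k (m ℕ.* k) {f} {g} le)) ⟩
    sum k g + sum (m ℕ.* k) (g ∘ (k ℕ.+_))    ≈⟨ sum-split k (m ℕ.* k) g ⟨
    sum (k ℕ.+ m ℕ.* k) g                     ∎

  -- The windows covering [0, n) are [0, k) and the ⌊n/k⌋ blocks ending at n, so
  -- that every index is covered at most twice.
  cover : ∀ {k n f g} → 0 ℕ.< k → k ℕ.≤ n → (∀ t → 0# ≤ f t) → (∀ t → 0# ≤ g t) →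
          WindowwiseLE k n f g → sum n f ≤ sum n g + sum n g
  cover {k@(suc _)} {n} {f} {g} _ k≤n 0≤f 0≤g le = begin
    sum n f                                ≡⟨ ≡.cong (λ m → sum m f) n≡r+mk ⟩
    sum (r ℕ.+ m ℕ.* k) f                  ≈⟨ sum-split r (m ℕ.* k) f ⟩
    sum r f + sum (m ℕ.* k) (f ∘ (r ℕ.+_)) ≤⟨ +-mono-≤ prefix (blocks k m (windowwise-shift k r (m ℕ.* k) {f} {g}
                                                (≡.subst (λ l → WindowwiseLE k l f g) n≡r+mk le))) ⟩
    sum n g + sum (m ℕ.* k) (g ∘ (r ℕ.+_)) ≤⟨ +-monoʳ-≤ _ (window≤sum {r} {m ℕ.* k} 0≤g
                                                (ℕ.≤-reflexive (≡.sym n≡r+mk))) ⟩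
    sum n g + sum n g                      ∎
    where
    r = n % k
    m = n / k

    n≡r+mk : n ≡ r ℕ.+ m ℕ.* k
    n≡r+mk = m≡m%n+[m/n]*n n k

    prefix : sum r f ≤ sum n g
    prefix = begin
      sum r f ≤⟨ window≤sum {0} 0≤f (ℕ.<⇒≤ (m%n<n n k)) ⟩
      sum k f ≤⟨ le 0 k≤n ⟩
      sum k g ≤⟨ window≤sum {0} 0≤g k≤n ⟩
      sum n g ∎

  -- Averaging β t * δ t ≤ β t * (δ u + Σ μ) over all u < k.
  weighted-window : ∀ {k q} {β δ μ : ℕ → Carrier} → 0 ℕ.< k → (∀ t → 0# ≤ β t) → 0# ≤ q → (∀ t → 0# ≤ δ t) →
                    (∀ t → 0# ≤ μ t) →
                    sum k β ≤ q * fromℕ k →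
                    (∀ t u → t ℕ.< k → u ℕ.< k → δ t ≤ δ u + sum k μ) →
                    sum k (λ t → β t * δ t) ≤ sum k (λ t → q * (δ t + fromℕ k * μ t))
  weighted-window {k} {q} {β} {δ} {μ} 0<k 0≤β 0≤q 0≤δ 0≤μ Σβ≤qK osc =
    *-cancelˡ-≤ K (1≤⇒0< (1≤fromℕ 0<k)) (begin
      K * sum k (λ t → β t * δ t)         ≈⟨ sum-const k _ ⟨
      sum k (const (sum k (λ t → β t * δ t))) ≤⟨ sum-mono k single ⟩
      sum k (λ u → q * K * (δ u + M))     ≈⟨ sum-*ˡ k (q * K) (λ u → δ u + M) ⟩
      q * K * sum k (λ u → δ u + M)       ≈⟨ *-congˡ (trans (sum-+ k δ (const M)) (+-congˡ (sum-const k M))) ⟩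
      q * K * (sum k δ + K * M)           ≈⟨ solve 4 (λ q K S M → q :* K :* (S :+ K :* M)
                                               := K :* (q :* (S :+ K :* M))) refl q K (sum k δ) M ⟩
      K * (q * (sum k δ + K * M))         ≈⟨ *-congˡ (*-congˡ (+-congˡ (sum-*ˡ k K μ))) ⟨
      K * (q * (sum k δ + sum k (λ t → K * μ t))) ≈⟨ *-congˡ (*-congˡ (sum-+ k δ (λ t → K * μ t))) ⟨
      K * (q * sum k (λ t → δ t + K * μ t)) ≈⟨ *-congˡ (sum-*ˡ k q (λ t → δ t + K * μ t)) ⟨
      K * sum k (λ t → q * (δ t + K * μ t)) ∎)
    where
    K = fromℕ k
    M = sum k μ

    single : ∀ u → u ℕ.< k → sum k (λ t → β t * δ t) ≤ q * K * (δ u + M)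
    single u u<k = begin
      sum k (λ t → β t * δ t)       ≤⟨ sum-mono k (λ t t<k → *-monoʳ-≤ (0≤β t) (osc t u t<k u<k)) ⟩
      sum k (λ t → β t * (δ u + M)) ≈⟨ sum-cong k (λ t _ → *-comm (β t) (δ u + M)) ⟩
      sum k (λ t → (δ u + M) * β t) ≈⟨ sum-*ˡ k (δ u + M) β ⟩
      (δ u + M) * sum k β           ≤⟨ *-monoʳ-≤ (+-nonNeg (0≤δ u) (sum-nonNeg k 0≤μ)) Σβ≤qK ⟩
      (δ u + M) * (q * K)           ≈⟨ *-comm _ _ ⟩
      q * K * (δ u + M)             ∎

  -- Going from `t` to `u` uses each step between them once, and the other steps only add to the
  -- sum. The `k` steps join `k + 1` values, so both indices may equal `k`.
  oscillation : ∀ k {δ μ : ℕ → Carrier} → (∀ t → 0# ≤ μ t) → (∀ t → δ t ≤ δ (suc t) + μ t) →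
                (∀ t → δ (suc t) ≤ δ t + μ t) →
                ∀ t u → t ℕ.≤ k → u ℕ.≤ k → δ t ≤ δ u + sum k μ
  oscillation k {δ} 0≤μ down up zero zero _ _ = x≤x+y _ (sum-nonNeg k 0≤μ)
  oscillation (suc k) {δ} {μ} 0≤μ down up zero (suc u) _ (s≤s u≤k) =
    from-≤ (+-mono-≤ (down 0) (oscillation k {δ ∘ suc} (0≤μ ∘ suc) (down ∘ suc) (up ∘ suc) 0 u z≤n u≤k))
      (solve 5 (λ a b c m s → a :+ ((b :+ m) :+ (c :+ s)) := (c :+ (m :+ s)) :+ (a :+ b))
        refl (δ 0) (δ 1) (δ (suc u)) (μ 0) (sum k (μ ∘ suc)))
  oscillation (suc k) {δ} {μ} 0≤μ down up (suc t) zero (s≤s t≤k) _ =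
    from-≤ (+-mono-≤ (oscillation k {δ ∘ suc} (0≤μ ∘ suc) (down ∘ suc) (up ∘ suc) t 0 t≤k z≤n) (up 0))
      (solve 5 (λ a b c m s → c :+ ((b :+ s) :+ (a :+ m)) := (a :+ (m :+ s)) :+ (c :+ b))
        refl (δ 0) (δ 1) (δ (suc t)) (μ 0) (sum k (μ ∘ suc)))
  oscillation (suc k) {δ} 0≤μ down up (suc t) (suc u) (s≤s t≤k) (s≤s u≤k) =
    ≤-trans (oscillation k {δ ∘ suc} (0≤μ ∘ suc) (down ∘ suc) (up ∘ suc) t u t≤k u≤k)
            (+-monoʳ-≤ (δ (suc u)) (x≤y+x _ (0≤μ 0)))

  indicator : ∀ {p} {P : Set p} → Dec P → Carrier
  indicator P? = if does P? then 1# else 0#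

  indicator-nonNeg : ∀ {p} {P : Set p} (P? : Dec P) → 0# ≤ indicator P?
  indicator-nonNeg (yes _) = 0≤1
  indicator-nonNeg (no _)  = ≤-refl

  indicator-mono : ∀ {p r} {P : Set p} {R : Set r} (P? : Dec P) (R? : Dec R) →
                   (P → R) → indicator P? ≤ indicator R?
  indicator-mono (no _)  R?      P⇒R = indicator-nonNeg R?
  indicator-mono (yes _) (yes _) P⇒R = ≤-refl
  indicator-mono (yes p) (no ¬r) P⇒R = ⊥-elim (¬r (P⇒R p))

  sum≤count : ∀ {a p} {A : Set a} {P : A → Set p} (P? : Decidable P) n (x : Fin n → A) f →
              (∀ i → f (toℕ i) ≤ indicator (P? (x i))) → sum n f ≤ fromℕ (count P? (tabulate x))
  sum≤count P? zero    x f le = ≤-refl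
  sum≤count P? (suc n) x f le with does (P? (x zero)) | le zero
  ... | true  | h = +-mono-≤ h (sum≤count P? n (x ∘ suc) (f ∘ suc) (le ∘ suc))
  ... | false | h = ≤-trans (+-mono-≤ h (sum≤count P? n (x ∘ suc) (f ∘ suc) (le ∘ suc)))
                            (≤-reflexive (+-identityˡ _))

-- Robustness of a near-optimal solution under mismatches

module PageMigration {a} (ℝ : RealField) (M : MetricSpace ℝ a) where
  open OrderedField ℝ
  open Sums ℝ
  open MetricSpace M
  open IsGeneralMetric isMetric using (0⇒≈; ≈⇒0; nonNegative; triangle) renaming (sym to d-sym)

  -- Bounds how much the distance between two moving pages changes in one step by what the two pages
  -- move.
  quadrilateral : ∀ w x y z → d w x ≤ d y z + (d w y + d x z)
  quadrilateral w x y z = from-≤ (+-mono-≤ (triangle w y x) (triangle y z x))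
    (trans (+-congˡ (+-congˡ (+-congˡ (d-sym z x))))
      (solve 5 (λ wx yz wy xz yx → wx :+ ((wy :+ yx) :+ (yz :+ xz)) := (yz :+ (wy :+ xz)) :+ (wx :+ yx))
        refl (d w x) (d y z) (d w y) (d x z) (d y x)))

  stepCost : Carrier → (x s : ℕ → Point) → ℕ → Carrier
  stepCost D x s t = D * d (x t) (x (suc t)) + d (x (suc t)) (s t)

  -- Positions are indexed so that x 0 is the start and request s t is served from x (suc t).
  totalCost : Carrier → ℕ → (x s : ℕ → Point) → Carrier
  totalCost D n x s = sum n (stepCost D x s)

  -- The weight `β` only has to dominate the mismatch indicator, so it may also be a sum of two such
  -- indicators. `ŝ` can be any reference sequence on which `x` is within `η` of `o`.
  robust : ∀ {D q η k n} {β : ℕ → Carrier} {x o s ŝ : ℕ → Point} →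
           0# ≤ D → 0# ≤ q → fromℕ k ≤ D → 0 ℕ.< k → k ℕ.≤ n →
           (∀ t → 0# ≤ β t) → (∀ t → s t ≡ ŝ t ⊎ 1# ≤ β t) →
           (∀ j → j ℕ.+ k ℕ.≤ n → sum k (β ∘ (j ℕ.+_)) ≤ q * fromℕ k) →
           totalCost D n x ŝ ≤ totalCost D n o ŝ + η →
           totalCost D n x s ≤ totalCost D n o s + η
             + fromℕ 4 * q * (totalCost D n x s + totalCost D n o s)
  robust {D} {q} {η} {k} {n} {β} {x} {o} {s} {ŝ} 0≤D 0≤q K≤D 0<k k≤n 0≤β s≡ŝ⊎1≤β Σβ≤qK opt =
    -- The factor 4 arises as 2 · 2: `exchanged` costs `B` twice, and each `B` is at most two copies
    -- of the charge because `cover` may use an index twice.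
    from-≤ (+-mono-≤ (+-mono-≤ exchanged (+-mono-≤ penalty penalty)) opt)
      (solve 7 (λ xs os xŝ oŝ η b q →
          xs :+ (((os :+ xŝ) :+ (b :+ b))
                 :+ (q :* (xs :+ os) :+ q :* (xs :+ os) :+ (q :* (xs :+ os) :+ q :* (xs :+ os)))
                 :+ (oŝ :+ η))
          := (os :+ η :+ (4 :× con 1) :* q :* (xs :+ os)) :+ (((xs :+ oŝ) :+ (b :+ b)) :+ xŝ))
        refl (C x s) (C o s) (C x ŝ) (C o ŝ) η B q)
    where
    C = totalCost D n
    K = fromℕ k

    δ : ℕ → Carrier
    δ t = d (x t) (o t)

    μ : ℕ → Carrier
    μ t = d (x t) (x (suc t)) + d (o t) (o (suc t))

    0≤μ : ∀ t → 0# ≤ μ t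
    0≤μ t = +-nonNeg nonNegative nonNegative

    δ-down : ∀ t → δ t ≤ δ (suc t) + μ t
    δ-down t = quadrilateral _ _ _ _

    δ-up : ∀ t → δ (suc t) ≤ δ t + μ t
    δ-up t = ≤-trans (quadrilateral _ _ _ _)
      (≤-reflexive (+-congˡ (+-cong (d-sym _ _) (d-sym _ _))))

    b : ℕ → Carrier
    b t = β t * δ (suc t)

    B = sum n b

    -- The share of index `t` in the averaged bound: one distance between the pages, plus the
    -- movement `μ t`, which counts once for each of the `k` averaged indices.
    charge : ℕ → Carrier
    charge t = q * (δ (suc t) + K * μ t)

    windows : WindowwiseLE k n b charge
    windows j j+k≤n = weighted-window {β = β ∘ (j ℕ.+_)} {δ = λ t → δ (suc (j ℕ.+ t))} {μ = μ ∘ (j ℕ.+_)}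
      0<k (λ t → 0≤β _) 0≤q (λ t → nonNegative) (λ t → 0≤μ _) (Σβ≤qK j j+k≤n) osc
      where
      suc-shift : ∀ t → δ (j ℕ.+ suc t) ≡ δ (suc (j ℕ.+ t))
      suc-shift t = ≡.cong δ (ℕ.+-suc j t)

      osc : ∀ t u → t ℕ.< k → u ℕ.< k → δ (suc (j ℕ.+ t)) ≤ δ (suc (j ℕ.+ u)) + sum k (μ ∘ (j ℕ.+_))
      osc t u t<k u<k = ≡.subst₂ (λ y z → y ≤ z + sum k (μ ∘ (j ℕ.+_))) (suc-shift t) (suc-shift u)
        -- The requests of the window are served at position indices `j + 1` to `j + k`, all reached
        -- by the `k` steps that start at index `j`.
        (oscillation k {δ = δ ∘ (j ℕ.+_)} (λ t → 0≤μ _)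
          (λ t → ≡.subst (λ y → δ (j ℕ.+ t) ≤ y + μ (j ℕ.+ t)) (≡.sym (suc-shift t)) (δ-down _))
          (λ t → ≡.subst (λ y → y ≤ δ (j ℕ.+ t) + μ (j ℕ.+ t)) (≡.sym (suc-shift t)) (δ-up _))
          (suc t) (suc u) t<k u<k)

    -- The detour through the actual request bounds the distance by the two service costs, and the
    -- movement costs cover the factor `K` since `K` is at most `D`.
    charge≤ : ∀ t → charge t ≤ q * (stepCost D x s t + stepCost D o s t)
    charge≤ t = *-monoʳ-≤ 0≤q
      (from-≤ (+-mono-≤ via-s Kμ≤Dμ)
        (solve 7 (λ D K xm om xs os xo → (xo :+ K :* (xm :+ om)) :+ ((xs :+ os) :+ D :* (xm :+ om))
            := ((D :* xm :+ xs) :+ (D :* om :+ os)) :+ (xo :+ K :* (xm :+ om)))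
          refl D K _ _ _ _ _))
      where
      via-s : δ (suc t) ≤ d (x (suc t)) (s t) + d (o (suc t)) (s t)
      via-s = ≤-trans (triangle _ (s t) _) (≤-reflexive (+-congˡ (d-sym _ _)))

      Kμ≤Dμ : K * μ t ≤ D * μ t
      Kμ≤Dμ = begin
        K * μ t ≈⟨ *-comm K (μ t) ⟩
        μ t * K ≤⟨ *-monoʳ-≤ (0≤μ t) K≤D ⟩
        μ t * D ≈⟨ *-comm (μ t) D ⟩
        D * μ t ∎

    Σcharge≤ : sum n charge ≤ q * (C x s + C o s)
    Σcharge≤ = begin
      sum n charge                                            ≤⟨ sum-mono n (λ t _ → charge≤ t) ⟩
      sum n (λ t → q * (stepCost D x s t + stepCost D o s t)) ≈⟨ sum-*ˡ n q _ ⟩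
      q * sum n (λ t → stepCost D x s t + stepCost D o s t)   ≈⟨ *-congˡ (sum-+ n _ _) ⟩
      q * (C x s + C o s)                                     ∎

    penalty : B ≤ q * (C x s + C o s) + q * (C x s + C o s)
    penalty = begin
      B                           ≤⟨ cover 0<k k≤n (λ t → *-nonNeg (0≤β t) nonNegative)
                                       (λ t → *-nonNeg 0≤q (+-nonNeg nonNegative
                                         (*-nonNeg (fromℕ-nonNeg k) (0≤μ t))))
                                       windows ⟩
      sum n charge + sum n charge ≤⟨ +-mono-≤ Σcharge≤ Σcharge≤ ⟩
      q * (C x s + C o s) + q * (C x s + C o s) ∎

    -- At an agreement the two distances merely change places. At a mismatch, switching between the
    -- two pages costs their distance once for `s` and once for `ŝ`, and `b t` is at least that
    -- distance.
    detour : ∀ t → d (x (suc t)) (s t) + d (o (suc t)) (ŝ t)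
                   ≤ (d (o (suc t)) (s t) + d (x (suc t)) (ŝ t)) + (b t + b t)
    detour t with s≡ŝ⊎1≤β t
    ... | inj₁ s≡ŝ rewrite s≡ŝ = ≤-trans (≤-reflexive (+-comm _ _)) (x≤x+y _ (+-nonNeg 0≤b 0≤b))
      where
      0≤b : 0# ≤ b t
      0≤b = *-nonNeg (0≤β t) nonNegative
    ... | inj₂ 1≤β = from-≤ (+-mono-≤ (+-mono-≤ (triangle (x (suc t)) (o (suc t)) (s t))
                                                (triangle (o (suc t)) (x (suc t)) (ŝ t)))
                                      (+-mono-≤ δ≤b δ′≤b))
      (solve 7 (λ xs oŝ os xŝ xo ox b →
          (xs :+ oŝ) :+ (((xo :+ os) :+ (ox :+ xŝ)) :+ (b :+ b))
          := ((os :+ xŝ) :+ (b :+ b)) :+ ((xs :+ oŝ) :+ (xo :+ ox)))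
        refl _ _ _ _ _ _ _)
      where
      δ≤b : δ (suc t) ≤ b t
      δ≤b = begin
        δ (suc t)          ≈⟨ *-identityʳ _ ⟨
        δ (suc t) * 1#     ≤⟨ *-monoʳ-≤ nonNegative 1≤β ⟩
        δ (suc t) * β t    ≈⟨ *-comm _ _ ⟩
        b t                ∎
      δ′≤b : d (o (suc t)) (x (suc t)) ≤ b t
      δ′≤b = ≤-trans (≤-reflexive (d-sym _ _)) δ≤b

    exchanged : C x s + C o ŝ ≤ (C o s + C x ŝ) + (B + B)
    exchanged = begin
      C x s + C o ŝ ≈⟨ sum-+ n _ _ ⟨
      sum n (λ t → stepCost D x s t + stepCost D o ŝ t)
        -- The movement terms are the same on both sides; only the service distances differ.
        ≤⟨ sum-mono n (λ t _ → from-≤ (detour t)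
             (solve 7 (λ xm om xs oŝ os xŝ b →
                 ((xm :+ xs) :+ (om :+ oŝ)) :+ ((os :+ xŝ) :+ (b :+ b))
                 := (((om :+ os) :+ (xm :+ xŝ)) :+ (b :+ b)) :+ (xs :+ oŝ))
               refl _ _ _ _ _ _ _)) ⟩
      sum n (λ t → (stepCost D o s t + stepCost D x ŝ t) + (b t + b t))
        ≈⟨ trans (sum-+ n _ _) (+-cong (sum-+ n _ _) (sum-+ n _ _)) ⟩
      (C o s + C x ŝ) + (B + B) ∎

  -- Costs of vectors and elementary bounds on them

  cost-nonNeg : ∀ {D n} → 0# ≤ D → ∀ p (x s : Vec Point n) → 0# ≤ cost ℝ M D p x s
  cost-nonNeg 0≤D p []      []      = ≤-refl
  cost-nonNeg 0≤D p (y ∷ x) (r ∷ s) =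
    +-nonNeg (+-nonNeg (*-nonNeg 0≤D nonNegative) nonNegative) (cost-nonNeg 0≤D y x s)

  -- Padding turns vectors into functions on ℕ, so that windows need no bounded indices. Sequences
  -- padded with the same point agree past the end, so padding creates no mismatch.
  extend : Point → ∀ {n} → Vec Point n → ℕ → Point
  extend y []      t       = y
  extend y (x ∷ v) zero    = x
  extend y (x ∷ v) (suc t) = extend y v t

  extend-toℕ : ∀ y {n} (v : Vec Point n) i → extend y v (toℕ i) ≡ lookup v i
  extend-toℕ y (x ∷ v) zero    = ≡.refl
  extend-toℕ y (x ∷ v) (suc i) = extend-toℕ y v i

  extend-replicate : ∀ y n t → extend y (replicate n y) t ≡ y
  extend-replicate y zero    t       = ≡.refl
  extend-replicate y (suc n) zero    = ≡.refl
  extend-replicate y (suc n) (suc t) = extend-replicate y n t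

  in-range-or-default : ∀ y n t →
    (∃[ i ] toℕ {n} i ≡ t) ⊎ (∀ (v : Vec Point n) → extend y v t ≡ y)
  in-range-or-default y zero    t       = inj₂ λ { [] → ≡.refl }
  in-range-or-default y (suc n) zero    = inj₁ (zero , ≡.refl)
  in-range-or-default y (suc n) (suc t) with in-range-or-default y n t
  ... | inj₁ (i , i≡t) = inj₁ (suc i , ≡.cong suc i≡t)
  ... | inj₂ default   = inj₂ λ { (x ∷ v) → default v }

  cost≈totalCost : ∀ D y {n} p (x s : Vec Point n) →
                   cost ℝ M D p x s ≈ totalCost D n (extend y (p ∷ x)) (extend y s)
  cost≈totalCost D y p []      []      = refl
  cost≈totalCost D y p (z ∷ x) (r ∷ s) = +-congˡ (cost≈totalCost D y z x s)

  move-to-self : ∀ D p z → D * d p p + z ≈ z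
  move-to-self D p z =
    trans (+-congʳ (trans (*-congˡ (≈⇒0 ≡.refl)) (zeroʳ D))) (+-identityˡ z)

  -- A move costs `D` times its length and saves at most its length on each of the at most `D`
  -- remaining requests. The induction lets the competitor start at another point `y`, which is
  -- worth at most `d p y` per request.
  stay-optimal : ∀ {D n} → fromℕ n ≤ D → ∀ p y (x s : Vec Point n) →
                 cost ℝ M D p (replicate n p) s ≤ cost ℝ M D y x s + fromℕ n * d p y
  stay-optimal n≤D p y [] [] = x≤x+y 0# (*-nonNeg ≤-refl nonNegative)
  stay-optimal {D} {suc n} n≤D p y (z ∷ x) (r ∷ s) = begin
    (D * d p p + d p r) + S  ≈⟨ +-congʳ (move-to-self D p _) ⟩
    d p r + S
      ≤⟨ from-≤ (+-mono-≤ (+-mono-≤ (triangle p z r) (stay-optimal n≤D′ p z x s))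
                  (+-mono-≤ (*-monoʳ-≤ (fromℕ-nonNeg (suc n)) (triangle p y z))
                            (*-monoʳ-≤ (nonNegative {y} {z}) n≤D)))
           (solve 9 (λ D m pr S O pz zr py yz →
               (pr :+ S) :+ (((pz :+ zr) :+ (O :+ m :* pz))
                             :+ ((con 1 :+ m) :* (py :+ yz) :+ yz :* D))
               := ((D :* yz :+ zr) :+ O :+ (con 1 :+ m) :* py)
                  :+ ((pr :+ S) :+ ((con 1 :+ m) :* pz :+ yz :* (con 1 :+ m))))
             refl D (fromℕ n) (d p r) S O (d p z) (d z r) (d p y) (d y z)) ⟩
    (D * d y z + d z r) + O + fromℕ (suc n) * d p y ∎
    where
    S = cost ℝ M D p (replicate n p) s
    O = cost ℝ M D z x s

    n≤D′ : fromℕ n ≤ D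
    n≤D′ = ≤-trans (fromℕ-mono (ℕ.n≤1+n n)) n≤D

  -- The moves up to index `i`, followed by the service of request `i`, form a path from `p` to that
  -- request, and each move costs at least its length.
  request-distance≤cost : ∀ {D n} → 1# ≤ D → ∀ p (x s : Vec Point n) i →
                          d p (lookup s i) ≤ cost ℝ M D p x s
  request-distance≤cost {D} 1≤D p (z ∷ x) (r ∷ s) i = begin
    d p (lookup (r ∷ s) i)               ≤⟨ triangle p z _ ⟩
    d p z + d z (lookup (r ∷ s) i)       ≤⟨ +-mono-≤ move (rest i) ⟩
    D * d p z + (d z r + cost ℝ M D z x s) ≈⟨ +-assoc _ _ _ ⟨
    cost ℝ M D p (z ∷ x) (r ∷ s)         ∎
    where
    move : d p z ≤ D * d p z
    move = begin
      d p z      ≈⟨ *-identityʳ _ ⟨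
      d p z * 1# ≤⟨ *-monoʳ-≤ nonNegative 1≤D ⟩
      d p z * D  ≈⟨ *-comm _ _ ⟩
      D * d p z  ∎

    rest : ∀ i → d z (lookup (r ∷ s) i) ≤ d z r + cost ℝ M D z x s
    rest zero    = x≤x+y _ (cost-nonNeg (≤-trans 0≤1 1≤D) z x s)
    rest (suc i) = ≤-trans (request-distance≤cost 1≤D z x s i) (x≤y+x _ nonNegative)

  stay-on-constant : ∀ D p n → cost ℝ M D p (replicate n p) (replicate n p) ≈ 0#
  stay-on-constant D p zero    = refl
  stay-on-constant D p (suc n) =
    trans (+-cong (trans (move-to-self D p _) (≈⇒0 ≡.refl)) (stay-on-constant D p n)) (+-identityˡ 0#)

  robust-cost : ∀ {D q η k n} {β : ℕ → Carrier} p (x o s ŝ : Vec Point n) →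
                0# ≤ D → 0# ≤ q → fromℕ k ≤ D → 0 ℕ.< k → k ℕ.≤ n →
                (∀ t → 0# ≤ β t) → (∀ t → extend p s t ≡ extend p ŝ t ⊎ 1# ≤ β t) →
                (∀ j → j ℕ.+ k ℕ.≤ n → sum k (β ∘ (j ℕ.+_)) ≤ q * fromℕ k) →
                cost ℝ M D p x ŝ ≤ cost ℝ M D p o ŝ + η →
                cost ℝ M D p x s ≤ cost ℝ M D p o s + η
                  + fromℕ 4 * q * (cost ℝ M D p x s + cost ℝ M D p o s)
  robust-cost {D} {q} {η} {n = n} p x o s ŝ 0≤D 0≤q K≤D 0<k k≤n 0≤β s≡ŝ⊎1≤β Σβ≤qK opt = begin
    cost ℝ M D p x s ≈⟨ cost≈ x s ⟩
    T x s ≤⟨ robust 0≤D 0≤q K≤D 0<k k≤n 0≤β s≡ŝ⊎1≤β Σβ≤qK (begin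
      T x ŝ                 ≈⟨ cost≈ x ŝ ⟨
      cost ℝ M D p x ŝ      ≤⟨ opt ⟩
      cost ℝ M D p o ŝ + η  ≈⟨ +-congʳ (cost≈ o ŝ) ⟩
      T o ŝ + η             ∎) ⟩
    T o s + η + fromℕ 4 * q * (T x s + T o s)
      ≈⟨ +-cong (+-congʳ (cost≈ o s)) (*-congˡ (+-cong (cost≈ x s) (cost≈ o s))) ⟨
    cost ℝ M D p o s + η + fromℕ 4 * q * (cost ℝ M D p x s + cost ℝ M D p o s) ∎
    where
    T : (x s : Vec Point n) → Carrier
    T x s = totalCost D n (extend p (p ∷ x)) (extend p s)

    cost≈ : ∀ x s → cost ℝ M D p x s ≈ T x s
    cost≈ = cost≈totalCost D p p

  -- Mismatch weights and the least predicted distance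

  module _ (_≟_ : DecidableEquality Point) where

    mismatch : Point → ∀ {n} → (s ŝ : Vec Point n) → ℕ → Carrier
    mismatch p s ŝ t = indicator (¬? (extend p s t ≟ extend p ŝ t))

    equal-or-mismatch : ∀ p {n} (s ŝ : Vec Point n) t →
                        extend p s t ≡ extend p ŝ t ⊎ 1# ≤ mismatch p s ŝ t
    equal-or-mismatch p s ŝ t with extend p s t ≟ extend p ŝ t
    ... | yes eq = inj₁ eq
    ... | no _   = inj₂ ≤-refl

    window-mismatches : ∀ p {n} (s ŝ : Vec Point n) j k → j ℕ.+ k ℕ.≤ n →
                        sum k (mismatch p s ŝ ∘ (j ℕ.+_)) ≤ fromℕ (mismatches _≟_ s ŝ j k)
    window-mismatches p {n} s ŝ j k j+k≤n = begin
      sum k (mismatch p s ŝ ∘ (j ℕ.+_))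
        ≤⟨ sum-mono k (λ t t<k → indicator-mono (¬? (extend p s (j ℕ.+ t) ≟ extend p ŝ (j ℕ.+ t)))
             (inWindow? (j ℕ.+ t)) ((ℕ.m≤m+n j t , ℕ.+-monoʳ-< j t<k) ,_)) ⟩
      sum k (indicator ∘ inWindow? ∘ (j ℕ.+_))
        ≤⟨ window≤sum {j} {k} (indicator-nonNeg ∘ inWindow?) j+k≤n ⟩
      sum n (indicator ∘ inWindow?)
        ≤⟨ sum≤count _ n (λ i → i) _ (λ i → indicator-mono (inWindow? (toℕ i)) (lookup? i)
             λ { (w , s≢ŝ) → w , λ eq → s≢ŝ (≡.trans (extend-toℕ p s i)
                   (≡.trans eq (≡.sym (extend-toℕ p ŝ i)))) }) ⟩
      fromℕ (mismatches _≟_ s ŝ j k) ∎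
      where
      inWindow? = λ i → (j ℕ.≤? i ×-dec i ℕ.<? j ℕ.+ k) ×-dec ¬? (extend p s i ≟ extend p ŝ i)
      lookup? = λ (i : Fin n) → (j ℕ.≤? toℕ i ×-dec toℕ i ℕ.<? j ℕ.+ k) ×-dec ¬? (lookup s i ≟ lookup ŝ i)

    separation : ∀ p {n} (s : Vec Point n) →
                 ∃[ c ] (0# < c × (∀ i → lookup s i ≢ p → c ≤ d p (lookup s i)))
    -- With no request away from `p` any positive value will do; otherwise the result is a minimum
    -- of finitely many positive numbers.
    separation p []      = 1# , 1≤⇒0< ≤-refl , λ ()
    separation p (r ∷ s) with separation p s | r ≟ p
    ... | c , 0<c , c≤ | yes r≡p = c , 0<c , λ { zero r≢p → ⊥-elim (r≢p r≡p) ; (suc i) → c≤ i }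
    ... | c , 0<c , c≤ | no r≢p with total c (d p r)
    ...   | inj₁ c≤d = c , 0<c , λ { zero _ → c≤d ; (suc i) → c≤ i }
    ...   | inj₂ d≤c = d p r , ≰⇒> (λ d≤0 → r≢p (≡.sym (0⇒≈ (antisym d≤0 nonNegative))))
                     , λ { zero _ → ≤-refl ; (suc i) r≢p → ≤-trans d≤c (c≤ i r≢p) }

-- Near-minimisers from completeness

module Classical {a} (em : ExcludedMiddle a) (ℝ : RealField) where
  open OrderedField ℝ
  open Sums ℝ

  -- If no such point existed, every value of `f` could be lowered by `η`. Then the supremum of the
  -- negated values, lowered by `η`, would still be an upper bound.
  near-minimum : ∀ {A : Set a} (f : A → Carrier) → A → (∀ x → 0# ≤ f x) →
                 ∀ {η} → 0# < η → ∃[ x ] (∀ y → f x ≤ f y + η)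
  near-minimum {A} f x₀ 0≤f {η} 0<η = decide em
    where
    -- Excluded middle at level a resizes the predicate "− x is a value of f".
    P : Carrier → Set
    P x = True (em {∃[ y ] f y + x ≈ 0#})

    P-intro : ∀ {x} y → f y + x ≈ 0# → P x
    P-intro y eq = fromWitness (y , eq)

    0-ub : ∀ {x} → P x → x ≤ 0#
    0-ub {x} Px with y , eq ← toWitness Px = ≤-trans (x≤y+x x (0≤f y)) (≤-reflexive eq)

    module _ (none : ¬ (∃[ x ] (∀ y → f x ≤ f y + η))) where

      improve : ∀ x → ∃[ y ] f y + η ≤ f x
      improve x with em {∃[ y ] f y + η ≤ f x}
      ... | yes found = found
      ... | no none′ = ⊥-elim (none (x , λ y → proj₁ (≰⇒> (λ le → none′ (y , le)))))

      lower-ub : ∀ {s} → UpperBound P s → UpperBound P (s + - η)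
      lower-ub {s} s-ub {x} Px with y , eq ← toWitness Px with z , fz+η≤fy ← improve y =
        from-≤ (+-mono-≤ fz+η≤fy (s-ub (P-intro z (-‿inverseʳ (f z))))) (begin-equality
          x + (f y + s)                    ≈⟨ solve 3 (λ x y s → x :+ (y :+ s) := (y :+ x) :+ s) refl x (f y) s ⟩
          (f y + x) + s                    ≈⟨ +-congʳ eq ⟩
          0# + s                           ≈⟨ trans (+-identityˡ s) (sym (trans (+-identityʳ _) (+-identityʳ s))) ⟩
          (s + 0#) + 0#                    ≈⟨ +-cong (+-congˡ (-‿inverseʳ η)) (-‿inverseʳ (f z)) ⟨
          (s + (η + - η)) + (f z + - f z)  ≈⟨ solve 5 (λ s η η′ z z′ → (s :+ (η :+ η′)) :+ (z :+ z′)
                                                := (s :+ η′) :+ ((z :+ η) :+ z′)) refl s η (- η) (f z) (- f z) ⟩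
          (s + - η) + ((f z + η) + - f z)  ∎)

    decide : Dec (∃[ x ] (∀ y → f x ≤ f y + η)) → ∃[ x ] (∀ y → f x ≤ f y + η)
    decide (yes found) = found
    decide (no none) with s , s-ub , s-least ← supremum P (- f x₀ , P-intro x₀ (-‿inverseʳ _)) (0# , 0-ub) =
      ⊥-elim (<⇒≱ 0<η (from-≤ (s-least (lower-ub none s-ub)) (begin-equality
        η + (s + - η)  ≈⟨ solve 3 (λ η s η′ → η :+ (s :+ η′) := s :+ (η :+ η′)) refl η s (- η) ⟩
        s + (η + - η)  ≈⟨ +-congˡ (-‿inverseʳ η) ⟩
        s + 0#         ≈⟨ +-comm s 0# ⟩
        0# + s         ∎)))

  -- Choosing the plan and following it

  module _ (M : MetricSpace ℝ a) where
    open MetricSpace M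
    open IsGeneralMetric isMetric using (nonNegative)
    open PageMigration ℝ M

    private
      _≟_ : DecidableEquality Point
      _≟_ _ _ = em

    good-plan : ∀ {ε q D k} → 0# < q → fromℕ 16 * q ≤ 1# → 1# ≤ D → ε * D ≤ D →
                0 ℕ.< k → ε * D ≈ fromℕ k →
                ∀ p n (ŝ : Vec Point n) → ∃[ x ] (∀ s → ErrorAssumption ℝ M _≟_ D ε q ŝ s →
                  ∀ o → cost ℝ M D p x s ≤ (1# + fromℕ 32 * q) * cost ℝ M D p o s)
    good-plan {ε} {q} {D} {k} 0<q@(0≤q , _) 16q≤1 1≤D εD≤D 0<k εD≈K p n ŝ with ℕ.≤-<-connex k n
    ... | inj₂ n<k = replicate n p , λ s _ o → begin
      cost ℝ M D p (replicate n p) s          ≤⟨ stay-optimal n≤D p p o s ⟩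
      -- The competitor starts at `p` as well, so the correction term vanishes.
      cost ℝ M D p o s + fromℕ n * d p p      ≈⟨ trans (+-comm _ _) (move-to-self (fromℕ n) p _) ⟩
      cost ℝ M D p o s                        ≤⟨ ≤-scale s o ⟩
      (1# + fromℕ 32 * q) * cost ℝ M D p o s  ∎
      where
      0≤D = ≤-trans 0≤1 1≤D

      n≤D : fromℕ n ≤ D
      n≤D = ≤-trans (fromℕ-mono (ℕ.<⇒≤ n<k)) (≤-trans (≤-reflexive (sym εD≈K)) εD≤D)

      ≤-scale : ∀ s o → cost ℝ M D p o s ≤ (1# + fromℕ 32 * q) * cost ℝ M D p o s
      ≤-scale s o = from-≤ (*-nonNeg (*-nonNeg (fromℕ-nonNeg 32) 0≤q) (cost-nonNeg 0≤D p o s))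
        (solve 2 (λ t O → O :+ t :* O := (con 1 :+ t) :* O :+ con 0) refl (fromℕ 32 * q) _)
    -- This case distinction refers to no actual request sequence, so the plan can be fixed in
    -- advance.
    ... | inj₁ k≤n = plan (em {∃[ s ] (Admissible s × ¬ (∃[ i ] Informative s i))})
      where
      0≤D = ≤-trans 0≤1 1≤D

      K≤D : fromℕ k ≤ D
      K≤D = ≤-trans (≤-reflexive (sym εD≈K)) εD≤D

      Admissible : Vec Point n → Set
      Admissible s = ErrorAssumption ℝ M _≟_ D ε q ŝ s

      Informative : Vec Point n → Fin n → Set a
      Informative s i = lookup ŝ i ≢ p × lookup s i ≡ lookup ŝ i

      few-mismatches : ∀ s → Admissible s → ∀ j → j ℕ.+ k ℕ.≤ n →
                       sum k (mismatch _≟_ p s ŝ ∘ (j ℕ.+_)) ≤ q * fromℕ k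
      few-mismatches s adm j j+k≤n = begin
        sum k (mismatch _≟_ p s ŝ ∘ (j ℕ.+_)) ≤⟨ window-mismatches _≟_ p s ŝ j k j+k≤n ⟩
        fromℕ (mismatches _≟_ s ŝ j k)        ≤⟨ adm j k j+k≤n (sym εD≈K) ⟩
        q * (ε * D)                           ≈⟨ *-congˡ εD≈K ⟩
        q * fromℕ k                           ∎

      plan : Dec (∃[ s ] (Admissible s × ¬ (∃[ i ] Informative s i))) →
             ∃[ x ] (∀ s → Admissible s →
               ∀ o → cost ℝ M D p x s ≤ (1# + fromℕ 32 * q) * cost ℝ M D p o s)
      plan (yes (s₀ , adm₀ , none)) = replicate n p , λ s adm o →
        absorb-error 0≤q 16q≤1 (cost-nonNeg 0≤D p o s) (begin
          cost ℝ M D p (replicate n p) s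
            -- The constant sequence `p` takes the role of the prediction. The mismatches of `s` and
            -- of `s₀` together have rate `q + q`, so the factor `4 * q` becomes `8 * q`.
            ≤⟨ robust-cost p (replicate n p) o s (replicate n p) 0≤D (+-nonNeg 0≤q 0≤q) K≤D 0<k k≤n
                 (λ t → +-nonNeg (indicator-nonNeg (¬? em)) (indicator-nonNeg (¬? em)))
                 (const-or-mismatch s)
                 (λ j j+k≤n → begin
                   sum k (λ t → β s (j ℕ.+ t))    ≈⟨ sum-+ k _ _ ⟩
                   sum k (mismatch _≟_ p s ŝ ∘ (j ℕ.+_)) + sum k (mismatch _≟_ p s₀ ŝ ∘ (j ℕ.+_))
                     ≤⟨ +-mono-≤ (few-mismatches s adm j j+k≤n) (few-mismatches s₀ adm₀ j j+k≤n) ⟩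
                   q * fromℕ k + q * fromℕ k       ≈⟨ solve 2 (λ q K → q :* K :+ q :* K := (q :+ q) :* K)
                                                        refl q (fromℕ k) ⟩
                   (q + q) * fromℕ k               ∎)
                 (begin
                   cost ℝ M D p (replicate n p) (replicate n p) ≈⟨ stay-on-constant D p n ⟩
                   0#                                 ≤⟨ cost-nonNeg 0≤D p o (replicate n p) ⟩
                   cost ℝ M D p o (replicate n p)     ≈⟨ +-identityʳ _ ⟨
                   cost ℝ M D p o (replicate n p) + 0# ∎) ⟩
          _ ≈⟨ solve 3 (λ q A O → (O :+ con 0) :+ (4 :× con 1) :* (q :+ q) :* (A :+ O)
                                  := O :+ (8 :× con 1) :* q :* (A :+ O)) refl q _ _ ⟩
          cost ℝ M D p o s + fromℕ 8 * q * (cost ℝ M D p (replicate n p) s + cost ℝ M D p o s) ∎)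
        where
        β : Vec Point n → ℕ → Carrier
        β s t = mismatch _≟_ p s ŝ t + mismatch _≟_ p s₀ ŝ t

        prediction-is-start : ∀ i → lookup s₀ i ≡ lookup ŝ i → lookup ŝ i ≡ p
        prediction-is-start i s₀≡ŝ with lookup ŝ i ≟ p
        ... | yes ŝ≡p = ŝ≡p
        ... | no ŝ≢p  = ⊥-elim (none (i , ŝ≢p , s₀≡ŝ))

        -- Where both `s` and `s₀` agree with `ŝ`, the prediction must be `p`, since `s₀` has no
        -- informative index.
        const-or-mismatch : ∀ s t → extend p s t ≡ extend p (replicate n p) t ⊎ 1# ≤ β s t
        const-or-mismatch s t with in-range-or-default p n t
        ... | inj₂ default = inj₁ (≡.trans (default s) (≡.sym (default (replicate n p))))
        ... | inj₁ (i , ≡.refl) with equal-or-mismatch _≟_ p s ŝ t | equal-or-mismatch _≟_ p s₀ ŝ t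
        ...   | inj₂ 1≤β | _         = inj₂ (≤-trans 1≤β (x≤x+y _ (indicator-nonNeg (¬? em))))
        ...   | inj₁ _   | inj₂ 1≤β  = inj₂ (≤-trans 1≤β (x≤y+x _ (indicator-nonNeg (¬? em))))
        ...   | inj₁ s≡ŝ | inj₁ s₀≡ŝ = inj₁ (≡.trans s≡ŝ (≡.trans
          (≡.trans (extend-toℕ p ŝ i) (prediction-is-start i
            (≡.trans (≡.sym (extend-toℕ p s₀ i)) (≡.trans s₀≡ŝ (extend-toℕ p ŝ i)))))
          (≡.sym (extend-replicate p n t))))
      plan (no ¬uninformative) with c , 0<c , c≤ ← separation _≟_ p ŝ
        -- The slack is `q * c`. Every admissible `s` is informative here, so `c` is at most `O` and
        -- the slack fits between the factors `4 * q` and `8 * q`.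
        with x , opt ← near-minimum (λ x → cost ℝ M D p x ŝ) (replicate n p)
                         (λ x → cost-nonNeg 0≤D p x ŝ) (*-pos 0<q 0<c)
        = x , λ s adm o → let A = cost ℝ M D p x s ; O = cost ℝ M D p o s in
        absorb-error 0≤q 16q≤1 (cost-nonNeg 0≤D p o s) (begin
          A ≤⟨ robust-cost p x o s ŝ 0≤D 0≤q K≤D 0<k k≤n (λ t → indicator-nonNeg (¬? em))
                 (equal-or-mismatch _≟_ p s ŝ) (few-mismatches s adm) (opt o) ⟩
          O + q * c + fromℕ 4 * q * (A + O)
            ≤⟨ from-≤ (+-mono-≤ (*-monoʳ-≤ 0≤q (c≤cost c≤ s adm o))
                        (*-nonNeg 0≤q (+-nonNeg (*-nonNeg (fromℕ-nonNeg 4) (cost-nonNeg 0≤D p x s))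
                                                (*-nonNeg (fromℕ-nonNeg 3) (cost-nonNeg 0≤D p o s)))))
                 (solve 4 (λ q c A O →
                     (O :+ q :* c :+ (4 :× con 1) :* q :* (A :+ O))
                       :+ (q :* O :+ q :* ((4 :× con 1) :* A :+ (3 :× con 1) :* O))
                     := (O :+ (8 :× con 1) :* q :* (A :+ O)) :+ (q :* c :+ con 0)) refl q c A O) ⟩
          O + fromℕ 8 * q * (A + O) ∎)
        where
        c≤cost : ∀ {c} → (∀ i → lookup ŝ i ≢ p → c ≤ d p (lookup ŝ i)) →
                 ∀ s → Admissible s → ∀ o → c ≤ cost ℝ M D p o s
        c≤cost {c} c≤ s adm o with em {∃[ i ] Informative s i}
        ... | no none = ⊥-elim (¬uninformative (s , adm , none))
        ... | yes (i , ŝ≢p , s≡ŝ) = begin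
          c                  ≤⟨ c≤ i ŝ≢p ⟩
          d p (lookup ŝ i)   ≡⟨ ≡.cong (d p) s≡ŝ ⟨
          d p (lookup s i)   ≤⟨ request-distance≤cost 1≤D p o s i ⟩
          cost ℝ M D p o s   ∎

    -- The positions are read off the plan whatever requests are revealed, so the run of this
    -- algorithm is the plan itself.
    follow : ∀ {D ε q ρ} →
      (∀ p n (ŝ : Vec Point n) → ∃[ x ] (∀ s → ErrorAssumption ℝ M _≟_ D ε q ŝ s →
        ∀ o → cost ℝ M D p x s ≤ ρ * cost ℝ M D p o s)) →
      ∃[ alg ] Competitive ℝ M _≟_ D ε q ρ alg
    follow {D} {ρ = ρ} plan = (λ p n ŝ i _ → lookup (proj₁ (plan p n ŝ)) i) , λ p n ŝ s adm o →
      ≡.subst (λ x → cost ℝ M D p x s ≤ ρ * cost ℝ M D p o s)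
        (≡.sym (tabulate∘lookup (proj₁ (plan p n ŝ)))) (proj₂ (plan p n ŝ) s adm o)

-- The constants and both competitive ratios

theorem1 : ∀ {a} (em : ExcludedMiddle a) (ℝ : RealField) →
    let open RealField ℝ in
    ∃[ C ] ∃[ q₀ ] (0# < C × 0# < q₀ × q₀ < 1# ×
    (∀ ε q D → 0# < ε → ε < 1# → 0# < q → q ≤ q₀ → 1# < D →
    IsPositiveInteger (ε * D) →
    (∀ (M : MetricSpace ℝ a) →
    ∃[ alg ] Competitive ℝ M (λ _ _ → em) D ε q ((1# + ε) * (1# + C * q)) alg)
    ×
    (∀ (M : MetricSpace ℝ a) → MetricSpace.IsUniform M →
    ∃[ alg ] Competitive ℝ M (λ _ _ → em) D ε q (1# + C * q) alg)))
theorem1 {a} em ℝ = C , q₀ , 1≤⇒0< (1≤fromℕ {32} z<s) , 0<q₀ , q₀<1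
  , λ { ε q D (0≤ε , _) (ε≤1 , _) 0<q q≤q₀ (1≤D , _) (k , 0<k , εD≈K) →
      let
        0≤D : 0# ≤ D
        0≤D = ≤-trans 0≤1 1≤D

        εD≤D : ε * D ≤ D
        εD≤D = begin
          ε * D  ≈⟨ *-comm ε D ⟩
          D * ε  ≤⟨ *-monoʳ-≤ 0≤D ε≤1 ⟩
          D * 1# ≈⟨ *-identityʳ D ⟩
          D      ∎

        16q≤1 : fromℕ 16 * q ≤ 1#
        16q≤1 = ≤-trans (*-monoʳ-≤ (fromℕ-nonNeg 16) q≤q₀) (≤-reflexive 16q₀≈1)

        plan : ∀ M p n (ŝ : Vec (MetricSpace.Point M) n) → _
        plan M = good-plan M 0<q 16q≤1 1≤D εD≤D 0<k εD≈K
      in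
        (λ M → follow M λ p n ŝ → let x , competitive = plan M p n ŝ in x , λ s adm o → begin
          cost ℝ M D p x s                         ≤⟨ competitive s adm o ⟩
          (1# + C * q) * cost ℝ M D p o s
            -- The factor `1# + ε` only enlarges a nonnegative bound.
            ≤⟨ from-≤ (*-nonNeg 0≤ε (*-nonNeg (+-nonNeg 0≤1 (*-nonNeg (fromℕ-nonNeg 32) (proj₁ 0<q)))
                                              (PageMigration.cost-nonNeg ℝ M 0≤D p o s)))
                 (solve 3 (λ ε r O → r :* O :+ ε :* (r :* O) := (con 1 :+ ε) :* r :* O :+ con 0)
                   refl ε (1# + C * q) _) ⟩
          (1# + ε) * (1# + C * q) * cost ℝ M D p o s ∎)
      , (λ M _ → follow M (plan M)) }
  where
  open OrderedField ℝ
  open Classical em ℝ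

  -- `C` and the reciprocal `q₀` of 16 are the constants of `absorb-error`.
  C = fromℕ 32

  0<16 : 0# < fromℕ 16
  0<16 = 1≤⇒0< (1≤fromℕ {16} z<s)

  q₀ = proj₁ (inverse (fromℕ 16) (proj₂ 0<16 ∘ sym))

  16q₀≈1 : fromℕ 16 * q₀ ≈ 1#
  16q₀≈1 = proj₂ (inverse (fromℕ 16) (proj₂ 0<16 ∘ sym))

  0<q₀ : 0# < q₀
  0<q₀ = ≰⇒> λ q₀≤0 → 1≰0 (begin
    1#             ≈⟨ 16q₀≈1 ⟨
    fromℕ 16 * q₀  ≤⟨ *-monoʳ-≤ (proj₁ 0<16) q₀≤0 ⟩
    fromℕ 16 * 0#  ≈⟨ zeroʳ _ ⟩
    0#             ∎)

  q₀<1 : q₀ < 1#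
  -- Otherwise 16 would be at most 1, and hence 15 at most 0.
  q₀<1 = ≰⇒> λ 1≤q₀ → <⇒≱ (1≤⇒0< (1≤fromℕ {15} z<s)) (from-≤ (begin
    fromℕ 16 * 1#  ≤⟨ *-monoʳ-≤ (proj₁ 0<16) 1≤q₀ ⟩
    fromℕ 16 * q₀  ≈⟨ 16q₀≈1 ⟩
    1#             ∎) (solve 1 (λ m → m :+ con 1 := con 0 :+ (con 1 :+ m) :* con 1) refl (fromℕ 15)))
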